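{- Let $G$ be a simple $r$-regular graph and let $f$ be a perfect $(b,c)$-coloring of $G$. Assume that there are vertices $u,v\in V(G)$ of different colors such that $|\mathcal N(u)\cap\mathcal N(v)|=h$. Then $$h\le b+c\le 2r-h.$$ If $b+c=h$, then all vertices of $\mathcal N(u)\setminus\mathcal N(v)$ have the same color as $u$, and all vertices of $\mathcal N(v)\setminus\mathcal N(u)$ have the same color as $v$. If $b+c=2r-h$, then all vertices of $\mathcal N(u)\setminus\mathcal N(v)$ have the same color as $v$, and all vertices of $\mathcal N(v)\setminus\mathcal N(u)$ have the same color as $u$. Finally, if the vertices $u$ and $v$ are adjacent, then $h+2\le b+c$.
   Context: A simple graph is undirected, without loops or multiple edges. $\mathcal N(v)$ is the set of vertices adjacent to $v$. A perfect $(b,c)$-coloring of an $r$-regular graph $G$ is a coloring $f:V(G)\to\{1,2\}$ with parameter matrix $S=\begin{pmatrix}a&b\\c&d\end{pmatrix}$, where $a+b=c+d=r$: every vertex of color $1$ has exactly $a$ neighbors of color $1$ and $b$ neighbors of color $2$, and every vertex of color $2$ has exactly $c$ neighbors of color $1$ and $d$ neighbors of color $2$. -}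

module Defs where

open import Level using (Level; _⊔_; suc)
open import Data.List.Base using (List; length)
open import Data.List.Membership.Propositional using () renaming (_∈_ to _∈ˡ_)
open import Data.List.Relation.Unary.Unique.Propositional using (Unique)
open import Data.Nat.Base using (ℕ; _+_)
open import Data.Product.Base using (∃-syntax; _×_)
open import Function.Bundles using (_⇔_)
open import Relation.Binary.Core using (Rel)
open import Relation.Binary.Definitions using (Symmetric; Irreflexive)
open import Relation.Binary.PropositionalEquality.Core using (_≡_)
open import Relation.Unary using (Pred; _∈_; _∩_)

private
  variable
    α ℓ : Level
    A : Set α

-- The subset P of A is finite with n elements: some duplicate-free list of
-- length n has exactly the elements of P as its entries. Proofs of x ∈ P are
-- not counted, so P need not be proof-irrelevant.
∣_∣≐_ : Pred A ℓ → ℕ → Set _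
∣_∣≐_ {A = A} P n =
  ∃[ xs ] Unique {A = A} xs × length xs ≡ n × (∀ x → x ∈ˡ xs ⇔ x ∈ P)

infix 4 ∣_∣≐_

-- The vertex set may be infinite; regularity below makes the graph locally
-- finite.
record SimpleGraph (v e : Level) : Set (suc (v ⊔ e)) where
  field
    Vertex     : Set v
    Adj        : Rel Vertex e
    adj-sym    : Symmetric Adj
    adj-irrefl : Irreflexive _≡_ Adj

  𝒩 : Vertex → Pred Vertex e
  𝒩 x y = Adj x y

data Color : Set where
  ① ② : Color

module _ {v e} (G : SimpleGraph v e) where
  open SimpleGraph G

  Regular : ℕ → Set _
  Regular r = ∀ x → ∣ 𝒩 x ∣≐ r

  ColorClass : (Vertex → Color) → Color → Pred Vertex _
  ColorClass f i x = f x ≡ i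

  record IsPerfectColoring (r b c : ℕ) (f : Vertex → Color) : Set (v ⊔ e) where
    field
      a d   : ℕ
      a+b≡r : a + b ≡ r
      c+d≡r : c + d ≡ r
      ①-① : ∀ x → f x ≡ ① → ∣ 𝒩 x ∩ ColorClass f ① ∣≐ a
      ①-② : ∀ x → f x ≡ ① → ∣ 𝒩 x ∩ ColorClass f ② ∣≐ b
      ②-① : ∀ x → f x ≡ ② → ∣ 𝒩 x ∩ ColorClass f ① ∣≐ c
      ②-② : ∀ x → f x ≡ ② → ∣ 𝒩 x ∩ ColorClass f ② ∣≐ d

{-# OPTIONS --safe #-}

-- Let i ≠ j be the two colors. Since each vertex has color i or j, 𝒩 u ∩ 𝒩 v is
-- contained in the disjoint union of the i-colored neighbors of u and the
-- j-colored neighbors of v. Choosing i to be the color of v, this union has b + c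
-- elements; choosing i to be the color of u, it has a + d = 2r − (b + c). This
-- gives the two bounds, and equality in either makes the inclusion an equality.
-- If u and v are adjacent, then for i the color of v the union also contains u
-- and v, which are not common neighbors.
module Submission where

open import Defs
open import Data.Nat.Base using (ℕ; _+_; _*_; _∸_; _≤_)
open import Data.Product.Base using (_×_)
open import Relation.Binary.PropositionalEquality.Core using (_≡_; _≢_)
open import Relation.Unary using (_∈_; _∩_; _∖_)

open import Data.List.Base using (List; []; _∷_; _++_; length)
open import Data.List.Membership.Propositional using () renaming (_∈_ to _∈ˡ_)
open import Data.List.Membership.Propositional.Properties
  using (∈-∃++; ∈-++⁺ˡ; ∈-++⁺ʳ; ∈-++⁻)
open import Data.List.Properties using (length-++; ++-identityʳ)
open import Data.List.Relation.Binary.Permutation.Propositional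
  using (_↭_; ↭-refl; ↭-trans; prep)
open import Data.List.Relation.Binary.Permutation.Propositional.Properties
  using (↭-length; ∈-resp-↭; shift)
open import Data.List.Relation.Binary.Subset.Propositional using () renaming (_⊆_ to _⊆ˡ_)
open import Data.List.Relation.Unary.All using ([]) renaming (lookup to All-lookup)
open import Data.List.Relation.Unary.AllPairs using ([]; _∷_)
open import Data.List.Relation.Unary.Any using (here; there)
open import Data.List.Relation.Unary.Unique.Propositional using (Unique)
open import Data.List.Relation.Unary.Unique.Propositional.Properties using (++⁺)
open import Data.Nat.Properties
  using (≤-reflexive; m+n≤o⇒m≤o; m+n≤o⇒n≤o; m+1+n≢m; m+n≤o⇒m≤o∸n; +-comm; +-identityʳ;
         +-monoʳ-≤; m+n∸m≡n; m∸[m∸n]≡n; module ≤-Reasoning)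
open import Data.Nat.Solver using (module +-*-Solver)
open import Data.Product.Base using (∃-syntax; _,_; proj₁; proj₂)
open import Data.Sum.Base using (_⊎_; inj₁; inj₂; [_,_]′; fromInj₂)
open import Function.Base using (_∘_)
open import Function.Bundles using (module Equivalence; mk⇔)
open import Level using (Level)
open import Relation.Binary.PropositionalEquality
  using (refl; sym; trans; cong; cong₂; subst; ≢-sym)
open import Relation.Nullary.Negation using (contradiction)
open import Relation.Unary using (Pred; _∪_; _⊆_; _⊥_; ｛_｝)

open Equivalence using (to; from)

private
  variable
    α ℓ₁ ℓ₂ : Level
    A : Set α
    P : Pred A ℓ₁
    Q : Pred A ℓ₂
    m n : ℕ

-- Induction on `xs`: its head `x` is cut out of `ys`, and the tail still lies in what remains
-- because it does not contain `x`. The leftover `zs` serves both the comparison of sizes and the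
-- case of equality.
Unique-⊆⇒↭-++ : ∀ {xs ys : List A} → Unique xs → xs ⊆ˡ ys → ∃[ zs ] ys ↭ xs ++ zs
Unique-⊆⇒↭-++ {xs = []} {ys} [] _ = ys , ↭-refl
Unique-⊆⇒↭-++ {xs = x ∷ xs} (x∉xs ∷ xs!) x∷xs⊆ys
  with as , bs , refl ← ∈-∃++ (x∷xs⊆ys (here refl))
  = let zs , as++bs↭xs++zs = Unique-⊆⇒↭-++ xs! xs⊆as++bs
    in zs , ↭-trans (shift x as bs) (prep x as++bs↭xs++zs)
  where
  xs⊆as++bs : xs ⊆ˡ as ++ bs
  xs⊆as++bs y∈xs with ∈-resp-↭ (shift x as bs) (x∷xs⊆ys (there y∈xs))
  ... | here y≡x  = contradiction (sym y≡x) (All-lookup x∉xs y∈xs)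
  ... | there y∈ = y∈

module _ {P : Pred A ℓ₁} {Q : Pred A ℓ₂}
         (P≐m : ∣ P ∣≐ m) (Q≐n : ∣ Q ∣≐ n) (P⊆Q : P ⊆ Q) where
  private
    xs = proj₁ P≐m
    ys = proj₁ Q≐n
    |xs|≡m = proj₁ (proj₂ (proj₂ P≐m))
    |ys|≡n = proj₁ (proj₂ (proj₂ Q≐n))
    xs⇔P = proj₂ (proj₂ (proj₂ P≐m))
    ys⇔Q = proj₂ (proj₂ (proj₂ Q≐n))

    ys↭xs++- : ∃[ zs ] ys ↭ xs ++ zs
    ys↭xs++- = Unique-⊆⇒↭-++ (proj₁ (proj₂ P≐m))
      (λ {x} x∈xs → from (ys⇔Q x) (P⊆Q (to (xs⇔P x) x∈xs)))

    zs = proj₁ ys↭xs++-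

    m+|zs|≡n : m + length zs ≡ n
    m+|zs|≡n = begin-equality
      m + length zs         ≡⟨ cong (_+ length zs) |xs|≡m ⟨
      length xs + length zs ≡⟨ length-++ xs ⟨
      length (xs ++ zs)     ≡⟨ ↭-length (proj₂ ys↭xs++-) ⟨
      length ys             ≡⟨ |ys|≡n ⟩
      n                     ∎
      where open ≤-Reasoning

  ⊆⇒≤ : m ≤ n
  ⊆⇒≤ = m+n≤o⇒m≤o m (≤-reflexive m+|zs|≡n)

  -- Equal sizes force the leftover `zs` to be empty, so `ys` is a permutation of `xs`.
  ⊆∧≡⇒⊇ : n ≡ m → Q ⊆ P
  ⊆∧≡⇒⊇ n≡m {x} x∈Q with zs | proj₂ ys↭xs++- | m+|zs|≡n
  ... | [] | ys↭xs++[] | _ = to (xs⇔P x)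
    (subst (x ∈ˡ_) (++-identityʳ xs) (∈-resp-↭ ys↭xs++[] (from (ys⇔Q x) x∈Q)))
  ... | _ ∷ _ | _ | m+1+k≡n = contradiction (trans m+1+k≡n n≡m) (m+1+n≢m m)

∪-size : P ⊥ Q → ∣ P ∣≐ m → ∣ Q ∣≐ n → ∣ P ∪ Q ∣≐ m + n
∪-size P⊥Q (xs , xs! , |xs|≡m , xs⇔P) (ys , ys! , |ys|≡n , ys⇔Q) =
  xs ++ ys ,
  ++⁺ xs! ys! (λ {x} (x∈xs , x∈ys) → P⊥Q (to (xs⇔P x) x∈xs , to (ys⇔Q x) x∈ys)) ,
  trans (length-++ xs) (cong₂ _+_ |xs|≡m |ys|≡n) ,
  λ x → mk⇔
    ([ inj₁ ∘ to (xs⇔P x) , inj₂ ∘ to (ys⇔Q x) ]′ ∘ ∈-++⁻ xs)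
    [ ∈-++⁺ˡ ∘ from (xs⇔P x) , ∈-++⁺ʳ xs ∘ from (ys⇔Q x) ]′

｛｝-size : (x : A) → ∣ ｛ x ｝ ∣≐ 1
｛｝-size x = x ∷ [] , [] ∷ [] , refl ,
  λ y → mk⇔ (λ where (here y≡x) → sym y≡x; (there ())) (here ∘ sym)

≡⊎≡ : ∀ {i j : Color} → i ≢ j → ∀ k → k ≡ i ⊎ k ≡ j
≡⊎≡ {①}     _   ① = inj₁ refl
≡⊎≡ {②}     _   ② = inj₁ refl
≡⊎≡ {①} {②} _   ② = inj₂ refl
≡⊎≡ {②} {①} _   ① = inj₂ refl
≡⊎≡ {①} {①} i≢i _ = contradiction refl i≢i
≡⊎≡ {②} {②} i≢i _ = contradiction refl i≢i

≢⇒≡ : ∀ {i j k : Color} → i ≢ j → k ≢ i → k ≡ j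
≢⇒≡ {k = k} i≢j k≢i = fromInj₂ (λ k≡i → contradiction k≡i k≢i) (≡⊎≡ i≢j k)

module _ {ℓᵥ ℓₑ} (G : SimpleGraph ℓᵥ ℓₑ) (f : SimpleGraph.Vertex G → Color)
         {u v : SimpleGraph.Vertex G} where
  open SimpleGraph G

  module _ {i j : Color} (i≢j : i ≢ j) where

    private
      -- Here `i` and `j` are not tied to `f u` and `f v`, so both assignments of the colors are
      -- instances of one argument.
      Cover : Pred Vertex _
      Cover = 𝒩 u ∩ ColorClass G f i ∪ 𝒩 v ∩ ColorClass G f j

      common⊆Cover : 𝒩 u ∩ 𝒩 v ⊆ Cover
      common⊆Cover {w} (u~w , v~w) with ≡⊎≡ i≢j (f w)
      ... | inj₁ fw≡i = inj₁ (u~w , fw≡i)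
      ... | inj₂ fw≡j = inj₂ (v~w , fw≡j)

    module _ {m n h : ℕ}
             (|𝒩u∩i| : ∣ 𝒩 u ∩ ColorClass G f i ∣≐ m)
             (|𝒩v∩j| : ∣ 𝒩 v ∩ ColorClass G f j ∣≐ n)
             (|𝒩u∩𝒩v| : ∣ 𝒩 u ∩ 𝒩 v ∣≐ h) where

      private
        |Cover| : ∣ Cover ∣≐ m + n
        |Cover| = ∪-size
          (λ ((_ , fw≡i) , (_ , fw≡j)) → i≢j (trans (sym fw≡i) fw≡j)) |𝒩u∩i| |𝒩v∩j|

      common-≤ : h ≤ m + n
      common-≤ = ⊆⇒≤ |𝒩u∩𝒩v| |Cover| common⊆Cover

      -- An `i`-colored neighbor of `u` lies in `Cover`, which now consists of common neighbors
      -- only; outside `𝒩 v` just the color `j` is left. The other half is symmetric.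
      common-≡ : m + n ≡ h →
        (∀ w → w ∈ 𝒩 u ∖ 𝒩 v → f w ≡ j) × (∀ w → w ∈ 𝒩 v ∖ 𝒩 u → f w ≡ i)
      common-≡ m+n≡h =
        (λ w (u~w , v≁w) →
          ≢⇒≡ i≢j λ fw≡i → v≁w (proj₂ (Cover⊆common (inj₁ (u~w , fw≡i))))) ,
        (λ w (v~w , u≁w) →
          ≢⇒≡ (≢-sym i≢j) λ fw≡j → u≁w (proj₁ (Cover⊆common (inj₂ (v~w , fw≡j)))))
        where
        Cover⊆common : Cover ⊆ 𝒩 u ∩ 𝒩 v
        Cover⊆common = ⊆∧≡⇒⊇ |𝒩u∩𝒩v| |Cover| common⊆Cover m+n≡h

      -- The colors make `v` an `i`-colored neighbor of `u`, and `u` a `j`-colored neighbor of `v`,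
      -- so both are in `Cover`. Irreflexivity makes them distinct and keeps them out of
      -- `𝒩 u ∩ 𝒩 v`.
      adjacent-common-≤ : f u ≡ j → f v ≡ i → Adj u v → 2 + h ≤ m + n
      adjacent-common-≤ fu≡j fv≡i u~v =
        ⊆⇒≤ |｛u｝∪｛v｝∪common| |Cover| λ where
          (inj₁ refl)        → inj₂ (adj-sym u~v , fu≡j)
          (inj₂ (inj₁ refl)) → inj₁ (u~v , fv≡i)
          (inj₂ (inj₂ w∈))   → common⊆Cover w∈
        where
        |｛u｝∪｛v｝∪common| : ∣ ｛ u ｝ ∪ (｛ v ｝ ∪ 𝒩 u ∩ 𝒩 v) ∣≐ 2 + h
        |｛u｝∪｛v｝∪common| = ∪-size
          (λ where
            (refl , inj₁ refl)      → adj-irrefl refl u~v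
            (refl , inj₂ (u~u , _)) → adj-irrefl refl u~u)
          (｛｝-size u)
          (∪-size (λ where (refl , _ , v~v) → adj-irrefl refl v~v)
            (｛｝-size v) |𝒩u∩𝒩v|)

  -- Named relative to the colors of `u` and `v`, so that it applies whichever of the two has color
  -- `①`. The separate `s` lets `b + c` be written in either order.
  common-neighbors : ∀ {i j} → i ≢ j → f u ≡ i → f v ≡ j →
    ∀ {a b c d r s h} → a + b ≡ r → c + d ≡ r → b + c ≡ s →
    ∣ 𝒩 u ∩ ColorClass G f i ∣≐ a → ∣ 𝒩 u ∩ ColorClass G f j ∣≐ b →
    ∣ 𝒩 v ∩ ColorClass G f i ∣≐ c → ∣ 𝒩 v ∩ ColorClass G f j ∣≐ d →
    ∣ 𝒩 u ∩ 𝒩 v ∣≐ h →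
    (h ≤ s × s ≤ 2 * r ∸ h)
    × (s ≡ h →
        (∀ w → w ∈ 𝒩 u ∖ 𝒩 v → f w ≡ i) × (∀ w → w ∈ 𝒩 v ∖ 𝒩 u → f w ≡ j))
    × (s ≡ 2 * r ∸ h →
        (∀ w → w ∈ 𝒩 u ∖ 𝒩 v → f w ≡ j) × (∀ w → w ∈ 𝒩 v ∖ 𝒩 u → f w ≡ i))
    × (Adj u v → h + 2 ≤ s)
  common-neighbors i≢j fu≡i fv≡j {a} {b} {c} {d} {r} {s} {h}
    a+b≡r c+d≡r refl 𝒩u∩i 𝒩u∩j 𝒩v∩i 𝒩v∩j 𝒩u∩𝒩v =
    -- Instances at `j≢i` have a cover of size `b + c`, those at `i≢j` one of size `a + d`.
    (common-≤ j≢i 𝒩u∩j 𝒩v∩i 𝒩u∩𝒩v , m+n≤o⇒m≤o∸n s s+h≤2r) ,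
    common-≡ j≢i 𝒩u∩j 𝒩v∩i 𝒩u∩𝒩v ,
    common-≡ i≢j 𝒩u∩i 𝒩v∩j 𝒩u∩𝒩v ∘ a+d≡h ,
    λ u~v → subst (_≤ s) (+-comm 2 h)
      (adjacent-common-≤ j≢i 𝒩u∩j 𝒩v∩i 𝒩u∩𝒩v fu≡i fv≡j u~v)
    where
    open ≤-Reasoning

    j≢i = ≢-sym i≢j

    s+[a+d]≡2r : s + (a + d) ≡ 2 * r
    s+[a+d]≡2r = begin-equality
      b + c + (a + d)   ≡⟨ solve 4 (λ a b c d →
                             b :+ c :+ (a :+ d) := a :+ b :+ (c :+ d)) refl a b c d ⟩
      a + b + (c + d)   ≡⟨ cong₂ _+_ a+b≡r c+d≡r ⟩
      r + r             ≡⟨ cong (r +_) (+-identityʳ r) ⟨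
      2 * r             ∎
      where open +-*-Solver

    -- The bound `h ≤ a + d`, turned into one on `s` by the total `2 * r`.
    s+h≤2r : s + h ≤ 2 * r
    s+h≤2r = begin
      s + h       ≤⟨ +-monoʳ-≤ s (common-≤ i≢j 𝒩u∩i 𝒩v∩j 𝒩u∩𝒩v) ⟩
      s + (a + d) ≡⟨ s+[a+d]≡2r ⟩
      2 * r       ∎

    a+d≡h : s ≡ 2 * r ∸ h → a + d ≡ h
    a+d≡h s≡2r∸h = begin-equality
      a + d               ≡⟨ m+n∸m≡n s (a + d) ⟨
      s + (a + d) ∸ s     ≡⟨ cong₂ _∸_ s+[a+d]≡2r s≡2r∸h ⟩
      -- Subtracting twice returns `h` because `h ≤ 2 * r`, which follows from `s+h≤2r`.
      2 * r ∸ (2 * r ∸ h) ≡⟨ m∸[m∸n]≡n (m+n≤o⇒n≤o s s+h≤2r) ⟩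
      h                   ∎

theorem3 : ∀ {ℓᵥ ℓₑ} (G : SimpleGraph ℓᵥ ℓₑ) → let open SimpleGraph G in
  ∀ (r : ℕ) → Regular G r →
  ∀ (b c : ℕ) (f : Vertex → Color) → IsPerfectColoring G r b c f →
  ∀ (u v : Vertex) → f u ≢ f v →
  ∀ (h : ℕ) → ∣ 𝒩 u ∩ 𝒩 v ∣≐ h →
  -- h ≤ r, so 2 * r ∸ h is never truncated
  (h ≤ b + c × b + c ≤ 2 * r ∸ h)
  × (b + c ≡ h →
      (∀ w → w ∈ 𝒩 u ∖ 𝒩 v → f w ≡ f u) × (∀ w → w ∈ 𝒩 v ∖ 𝒩 u → f w ≡ f v))
  × (b + c ≡ 2 * r ∸ h →
      (∀ w → w ∈ 𝒩 u ∖ 𝒩 v → f w ≡ f v) × (∀ w → w ∈ 𝒩 v ∖ 𝒩 u → f w ≡ f u))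
  × (Adj u v → h + 2 ≤ b + c)
theorem3 G r _ b c f perfect u v fu≢fv h 𝒩u∩𝒩v with f u in fu | f v in fv
... | ① | ① = contradiction refl fu≢fv
... | ② | ② = contradiction refl fu≢fv
... | ① | ② = common-neighbors G f fu≢fv fu fv a+b≡r c+d≡r refl
  (①-① u fu) (①-② u fu) (②-① v fv) (②-② v fv) 𝒩u∩𝒩v
  where open IsPerfectColoring perfect
-- With the colors exchanged, `a`, `b`, `c`, `d` of the lemma become `d`, `c`, `b`, `a`.
... | ② | ① = common-neighbors G f fu≢fv fu fv
  (trans (+-comm d c) c+d≡r) (trans (+-comm b a) a+b≡r) (+-comm c b)
  (②-② u fu) (②-① u fu) (①-② v fv) (①-① v fv) 𝒩u∩𝒩v
  where open IsPerfectColoring perfect
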